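{- $5 \leq \chi_p(\mathcal{G}^{{\rm mad}}_{3}) \leq 7$.
   Context: An oriented graph is a loopless directed graph without opposite arcs (an orientation $\overrightarrow{G}$ of a simple undirected graph $G$). Pushing a vertex $v$ means reversing the orientation of every arc incident with $v$. Two oriented graphs are in a push relationship if one can be obtained from the other by pushing some set of vertices. A homomorphism $\overrightarrow{G}\to\overrightarrow{H}$ is a vertex map sending each arc $uv$ to an arc $\phi(u)\phi(v)$. A pushable homomorphism from $\overrightarrow{G}$ to $\overrightarrow{H}$ is a map that is a homomorphism from some oriented graph in a push relationship with $\overrightarrow{G}$ to $\overrightarrow{H}$. The pushable chromatic number $\chi_p(\overrightarrow{G})$ is the minimum number of vertices of an oriented graph $\overrightarrow{H}$ admitting a pushable homomorphism from $\overrightarrow{G}$. For an undirected graph $G$, $\chi_p(G)=\max\chi_p(\overrightarrow{G})$ over all orientations of $G$; for a family $\mathcal{F}$, $\chi_p(\mathcal{F})=\max_{G\in\mathcal{F}}\chi_p(G)$. The maximum average degree of $G$ is ${\rm mad}(G)=\max\{2|E(H)|/|V(H)| : H \text{ a subgraph of } G\}$, and $\mathcal{G}^{{\rm mad}}_3=\{G : {\rm mad}(G)<3\}$. -}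

module Defs where

open import Data.Nat using (ℕ; zero; suc; _+_; _*_; _≤_; _<_)
open import Data.Fin using (Fin; zero; suc)
open import Data.Bool using (Bool; true; false; if_then_else_; _∨_; _∧_; _xor_)
open import Data.Product using (Σ; Σ-syntax; ∃; ∃-syntax; _×_)
open import Relation.Binary.PropositionalEquality using (_≡_)

record Graph (n : ℕ) : Set where
  field
    adj   : Fin n → Fin n → Bool
    irrefl : ∀ i → adj i i ≡ false
    sym   : ∀ i j → adj i j ≡ adj j i
open Graph public

record OrientedGraph (n : ℕ) : Set where
  field
    arc    : Fin n → Fin n → Bool
    loopless : ∀ i → arc i i ≡ false
    noOpposite : ∀ i j → arc i j ≡ true → arc j i ≡ false
open OrientedGraph public

-- O is an orientation of G: uv is an edge of G iff exactly one of the arcs uv, vu is in O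
-- (at most one is guaranteed by noOpposite).
IsOrientationOf : ∀ {n} → OrientedGraph n → Graph n → Set
IsOrientationOf O G = ∀ i j → adj G i j ≡ (arc O i j ∨ arc O j i)

card : ∀ {n} → (Fin n → Bool) → ℕ
card {zero}  f = 0
card {suc n} f = (if f zero then 1 else 0) + card (λ i → f (suc i))

-- Number of ordered pairs (i , j) with h i j = true.
-- For a symmetric loopless h this is twice the number of edges.
cardPairs : ∀ {n} → (Fin n → Fin n → Bool) → ℕ
cardPairs {zero}  h = 0
cardPairs {suc n} h = card (h zero) + cardPairs (λ i j → h (suc i) (suc j))
  + card (λ j → h (suc j) zero)

record Subgraph {n : ℕ} (G : Graph n) : Set where
  field
    vert : Fin n → Bool
    edge : Fin n → Fin n → Bool
    edge-sym : ∀ i j → edge i j ≡ edge j i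
    edge⊆adj : ∀ i j → edge i j ≡ true → adj G i j ≡ true
    edge⊆vert : ∀ i j → edge i j ≡ true → vert i ≡ true
open Subgraph public

-- mad(G) < 3 : for every subgraph H with at least one vertex,
-- 2|E(H)| / |V(H)| < 3, i.e. 2|E(H)| < 3 |V(H)|.
MadLt3 : ∀ {n} → Graph n → Set
MadLt3 G = (H : Subgraph G) → 0 < card (vert H) →
  cardPairs (edge H) < 3 * card (vert H)

push : ∀ {n} → (Fin n → Bool) → (Fin n → Fin n → Bool) → (Fin n → Fin n → Bool)
push P a u v = if (P u xor P v) then a v u else a u v

IsHom : ∀ {n k} → (Fin n → Fin n → Bool) → OrientedGraph k → (Fin n → Fin k) → Set
IsHom a H φ = ∀ u v → a u v ≡ true → arc H (φ u) (φ v) ≡ true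

PushColorable : ∀ {n} → OrientedGraph n → ℕ → Set
PushColorable {n} O k =
  Σ[ H ∈ OrientedGraph k ] Σ[ P ∈ (Fin n → Bool) ] Σ[ φ ∈ (Fin n → Fin k) ]
    IsHom (push P (arc O)) H φ

ChiPLe : ∀ {n} → OrientedGraph n → ℕ → Set
ChiPLe O m = ∃[ k ] (k ≤ m × PushColorable O k)

{-# OPTIONS --safe #-}
-- Lower bound: two vertices receive different colours if they are adjacent or
-- opposite in a 4-cycle with an odd number of forward arcs, a parity that
-- pushing preserves.  In a suitable orientation of K₂,₃ plus an edge this
-- applies to all pairs of the five vertices.
--
-- Upper bound: the target is the Paley tournament QR₇.  A vertex has 14 states
-- (colour, pushed or not); one coloured neighbour leaves 6 of them, two leave
-- none or at least 2, and a neighbour of degree 2 whose other neighbour is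
-- coloured forbids at most one.  Hence a vertex with k neighbours of degree at
-- most 2 and r other neighbours, k + 2r ≤ 5 and k ≥ 1, can be recoloured so
-- that a colouring of the graph without those k neighbours extends to them.
-- Discharging shows that mad < 3 forces such a vertex or one of degree at most 1.
module Submission where

open import Defs
open import Data.Bool using (Bool; true; false; not; if_then_else_; _∧_; _∨_; _xor_)
import Data.Bool.Properties as Bool
open import Data.Empty using (⊥; ⊥-elim)
open import Data.Fin using (Fin; zero; suc; toℕ; quotient; remainder; combine; opposite)
open import Data.Fin.Patterns using (0F; 1F; 2F; 3F; 4F)
open import Data.Fin.Properties using (_≟_; all?; any?; pigeonhole; <⇒≢)
open import Data.Nat using (ℕ; zero; suc; _+_; _*_; _∸_; _%_; _≤_; _<_; z≤n; s≤s; s≤s⁻¹; _≤?_; _<?_)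
open import Data.Nat.Properties hiding (_≟_; <⇒≢)
open import Data.Nat.Tactic.RingSolver using (solve-∀)
open import Data.Product using (Σ-syntax; ∃-syntax; _×_; _,_; proj₁)
open import Data.Sum using (_⊎_; inj₁; inj₂; [_,_]′)
open import Data.Vec using (_∷_; []; lookup)
open import Data.Vec.Functional using (updateAt)
open import Data.Vec.Functional.Properties using (updateAt-updates; updateAt-minimal)
open import Function using (_∘_; const)
open import Relation.Binary.PropositionalEquality using (_≡_; _≢_; refl; trans; cong; cong₂; subst; subst₂; module ≡-Reasoning) renaming (sym to ≡-sym)
open import Relation.Nullary using (¬_; Dec; yes; no; does; contradiction)
open import Relation.Nullary.Decidable using (from-yes; map′; dec-true; dec-false; _×-dec_; _⊎-dec_; _→-dec_)
open import Relation.Unary using (Decidable)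

open import Algebra.Properties.Semiring.Sum +-*-semiring using (sum; sum-cong-≗; ∑-distrib-+; ∑-comm; *-distribˡ-sum)

private
  variable
    k m n : ℕ

-- Finite sets of vertices

VSet : ℕ → Set
VSet n = Fin n → Bool

infix  4 _∈_ _⊆_
infixl 7 _∩_
infixl 6 _∪_ _∖_

_∈_ : Fin n → VSet n → Set
i ∈ A = A i ≡ true

_⊆_ : VSet n → VSet n → Set
A ⊆ B = ∀ i → i ∈ A → i ∈ B

_∩_ _∪_ _∖_ : VSet n → VSet n → VSet n
(A ∩ B) i = A i ∧ B i
(A ∪ B) i = A i ∨ B i
(A ∖ B) i = A i ∧ not (B i)

⁅_⁆ : Fin n → VSet n
⁅ x ⁆ i = does (x ≟ i)

does⇒ : ∀ {A : Set} (d : Dec A) → does d ≡ true → A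
does⇒ (yes a) _ = a

∧-intro : ∀ {a b} → a ≡ true → b ≡ true → a ∧ b ≡ true
∧-intro refl refl = refl

∧-elimˡ : ∀ {a b} → a ∧ b ≡ true → a ≡ true
∧-elimˡ {true} _ = refl

∧-elimʳ : ∀ {a b} → a ∧ b ≡ true → b ≡ true
∧-elimʳ {true} p = p

∈-∪⁻ : ∀ (A B : VSet n) {i} → i ∈ A ∪ B → i ∈ A ⊎ i ∈ B
∈-∪⁻ A B {i} p with A i
... | true  = inj₁ refl
... | false = inj₂ p

∈-∪⁺ˡ : ∀ (A B : VSet n) → A ⊆ A ∪ B
∈-∪⁺ˡ A B i p rewrite p = refl

x∈⁅x⁆ : ∀ (x : Fin n) → x ∈ ⁅ x ⁆
x∈⁅x⁆ x = dec-true (x ≟ x) refl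

∈-⁅⁆⁻ : ∀ {x i : Fin n} → i ∈ ⁅ x ⁆ → x ≡ i
∈-⁅⁆⁻ {x = x} {i} = does⇒ (x ≟ i)

∈-∖⁅⁆⁺ : ∀ {A : VSet n} {x i} → i ∈ A → x ≢ i → i ∈ A ∖ ⁅ x ⁆
∈-∖⁅⁆⁺ {x = x} {i} p x≢i = ∧-intro p (cong not (dec-false (x ≟ i) x≢i))

∈-∖⁅⁆⁻ : ∀ {A : VSet n} {x i} → i ∈ A ∖ ⁅ x ⁆ → x ≢ i
∈-∖⁅⁆⁻ {A = A} {x} {i} p with x ≟ i
... | yes _  = contradiction (∧-elimʳ {A i} p) λ ()
... | no x≢i = x≢i

-- Cardinalities and sums

[_] : Bool → ℕ
[ b ] = if b then 1 else 0

card≡sum : ∀ (A : VSet n) → card A ≡ sum (λ i → [ A i ])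
card≡sum {zero}  A = refl
card≡sum {suc n} A = cong ([ A zero ] +_) (card≡sum (A ∘ suc))

[]-mono : ∀ {a b} → (a ≡ true → b ≡ true) → [ a ] ≤ [ b ]
[]-mono {false} f = z≤n
[]-mono {true}  f rewrite f refl = ≤-refl

card-mono : ∀ (A B : VSet n) → A ⊆ B → card A ≤ card B
card-mono {zero}  A B A⊆B = z≤n
card-mono {suc n} A B A⊆B =
  +-mono-≤ ([]-mono (A⊆B zero)) (card-mono (A ∘ suc) (B ∘ suc) (A⊆B ∘ suc))

card-cong : ∀ {A B : VSet n} → (∀ i → A i ≡ B i) → card A ≡ card B
card-cong {zero}  e = refl
card-cong {suc n} e = cong₂ (λ b c → [ b ] + c) (e zero) (card-cong (e ∘ suc))

card-false : ∀ n → card {n} (const false) ≡ 0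
card-false zero    = refl
card-false (suc n) = card-false n

card-⁅⁆ : ∀ (x : Fin n) → card ⁅ x ⁆ ≡ 1
card-⁅⁆ {suc n} zero    = cong suc (card-false n)
card-⁅⁆ {suc n} (suc x) = card-⁅⁆ x

card-split : ∀ (A B : VSet n) → card A ≡ card (A ∩ B) + card (A ∖ B)
card-split {zero}  A B = refl
card-split {suc n} A B with A zero | B zero
... | true  | true  = cong suc (card-split (A ∘ suc) (B ∘ suc))
... | true  | false = trans (cong suc (card-split (A ∘ suc) (B ∘ suc))) (≡-sym (+-suc _ _))
... | false | _     = card-split (A ∘ suc) (B ∘ suc)

∈⇒0<card : ∀ (A : VSet n) {x} → x ∈ A → 0 < card A
∈⇒0<card A {zero}  p rewrite p = s≤s z≤n
∈⇒0<card A {suc x} p = ≤-trans (∈⇒0<card (A ∘ suc) p) (m≤n+m _ [ A zero ])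

0<card⇒∃ : ∀ (A : VSet n) → 0 < card A → ∃[ x ] x ∈ A
0<card⇒∃ {suc n} A p with A zero in eq
... | true  = zero , eq
... | false with 0<card⇒∃ (A ∘ suc) p
...   | x , x∈A = suc x , x∈A

card-∖⁅⁆-< : ∀ (A : VSet n) {x} → x ∈ A → card (A ∖ ⁅ x ⁆) < card A
card-∖⁅⁆-< A {x} x∈A rewrite card-split A ⁅ x ⁆ =
  +-monoˡ-≤ _ (∈⇒0<card (A ∩ ⁅ x ⁆) (∧-intro x∈A (x∈⁅x⁆ x)))

card≤1+card-∖⁅⁆ : ∀ (A : VSet n) x → card A ≤ suc (card (A ∖ ⁅ x ⁆))
card≤1+card-∖⁅⁆ A x rewrite card-split A ⁅ x ⁆ =
  +-monoˡ-≤ _ (≤-trans (card-mono (A ∩ ⁅ x ⁆) ⁅ x ⁆ λ i → ∧-elimʳ {A i}) (≤-reflexive (card-⁅⁆ x)))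

card≤0⇒∉ : ∀ (A : VSet n) {x} → card A ≤ 0 → ¬ x ∈ A
card≤0⇒∉ A p x∈A = <⇒≱ (∈⇒0<card A x∈A) p

card-≤1+-pick : ∀ (A : VSet n) → card A ≤ suc m →
                card A ≤ 0 ⊎ ∃[ x ] (x ∈ A × card (A ∖ ⁅ x ⁆) ≤ m)
card-≤1+-pick A p with card A ≤? 0
... | yes q = inj₁ q
... | no ¬q with 0<card⇒∃ A (≰⇒> ¬q)
...   | x , x∈A = inj₂ (x , x∈A , s≤s⁻¹ (≤-trans (card-∖⁅⁆-< A x∈A) p))

card≤1⇒≡ : ∀ (A : VSet n) {i j} → card A ≤ 1 → i ∈ A → j ∈ A → i ≡ j
card≤1⇒≡ A {i} {j} p i∈A j∈A with i ≟ j
... | yes i≡j = i≡j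
... | no i≢j  = contradiction (∈-∖⁅⁆⁺ {A = A} j∈A i≢j)
  (card≤0⇒∉ (A ∖ ⁅ i ⁆) (s≤s⁻¹ (≤-trans (card-∖⁅⁆-< A i∈A) p)))

-- Greedy choice: each member of `W` strikes at most one element off `A`, so a strict inequality of
-- sizes leaves one.
avoid : ∀ (A : VSet k) (W : VSet n) (g : Fin n → Fin k) → card W < card A →
        ∃[ t ] (t ∈ A × (∀ {w} → w ∈ W → t ≢ g w))
avoid {n = zero}  A W g p with 0<card⇒∃ A p
... | t , t∈A = t , t∈A , λ { {()} }
avoid {n = suc n} A W g p with W zero in eq
... | false with avoid A (W ∘ suc) (g ∘ suc) p
...   | t , t∈A , h = t , t∈A , λ { {zero} q → contradiction (trans (≡-sym eq) q) λ () ; {suc w} → h }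
avoid {n = suc n} A W g p | true
  with avoid (A ∖ ⁅ g zero ⁆) (W ∘ suc) (g ∘ suc) (s≤s⁻¹ (≤-trans p (card≤1+card-∖⁅⁆ A (g zero))))
... | t , t∈A′ , h = t , ∧-elimˡ t∈A′ ,
  λ { {zero} _ t≡g → ∈-∖⁅⁆⁻ {A = A} t∈A′ (≡-sym t≡g) ; {suc w} → h }

sum-<⇒∃ : ∀ (f g : Fin n → ℕ) → sum f < sum g → ∃[ i ] f i < g i
sum-<⇒∃ {zero}  f g ()
sum-<⇒∃ {suc n} f g p with f zero <? g zero
... | yes q = zero , q
... | no ¬q with sum-<⇒∃ (f ∘ suc) (g ∘ suc) (+-cancelˡ-< (g zero) _ _ (≤-<-trans (+-monoˡ-≤ _ (≮⇒≥ ¬q)) p))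
...   | i , r = suc i , r

cardPairs-mono : ∀ (h h′ : Fin n → Fin n → Bool) →
                 (∀ i → h i ⊆ h′ i) → cardPairs h ≤ cardPairs h′
cardPairs-mono {zero}  h h′ _ = z≤n
cardPairs-mono {suc n} h h′ f =
  +-mono-≤ (+-mono-≤ (card-mono (h zero) (h′ zero) (f zero))
                     (cardPairs-mono (λ i j → h (suc i) (suc j)) (λ i j → h′ (suc i) (suc j))
                                     λ i j → f (suc i) (suc j)))
           (card-mono (λ j → h (suc j) zero) (λ j → h′ (suc j) zero) λ j → f (suc j) zero)

-- `cardPairs` peels off row and column zero together; handing the entries of the column back to the
-- remaining rows gives the row sums.
cardPairs≡sum : ∀ (h : Fin n → Fin n → Bool) → cardPairs h ≡ sum (λ i → card (h i))
cardPairs≡sum {zero}  h = refl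
cardPairs≡sum {suc n} h = begin
  card (h zero) + cardPairs h′ + card c
    ≡⟨ +-assoc (card (h zero)) _ _ ⟩
  card (h zero) + (cardPairs h′ + card c)
    ≡⟨ cong (card (h zero) +_) (+-comm (cardPairs h′) _) ⟩
  card (h zero) + (card c + cardPairs h′)
    ≡⟨ cong (card (h zero) +_) (cong₂ _+_ (card≡sum c) (cardPairs≡sum h′)) ⟩
  card (h zero) + (sum (λ i → [ c i ]) + sum (λ i → card (h′ i)))
    ≡⟨ cong (card (h zero) +_) (∑-distrib-+ (λ i → [ c i ]) (λ i → card (h′ i))) ⟨
  sum (λ i → card (h i)) ∎
  where
  open ≡-Reasoning
  h′ = λ i j → h (suc i) (suc j)
  c = λ j → h (suc j) zero

-- Boolean case checks, pushing and induced edges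

∀Bool? : ∀ {P : Bool → Set} → Decidable P → Dec (∀ b → P b)
∀Bool? P? = map′ (λ { (t , f) true → t ; (t , f) false → f }) (λ h → h true , h false)
                 (P? true ×-dec P? false)

module _ (P : Fin n → Bool) (a b : Fin n → Fin n → Bool) where

  -- Pushing the same set twice changes nothing, so a push moves from one side of an implication to
  -- the other. If exactly one end is pushed, the hypothesis is applied to the reversed pair, hence
  -- `f v u` beside `f u v`.
  pushˡ⇒pushʳ : (∀ u v → push P a u v ≡ true → b u v ≡ true) →
                ∀ {u v} → a u v ≡ true → push P b u v ≡ true
  pushˡ⇒pushʳ f {u} {v} h with f u v | f v u
  ... | fuv | fvu with P u | P v
  ... | true  | true  = fuv h
  ... | true  | false = fvu h
  ... | false | true  = fvu h
  ... | false | false = fuv h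

  pushʳ⇒pushˡ : (∀ u v → a u v ≡ true → push P b u v ≡ true) →
                ∀ {u v} → push P a u v ≡ true → b u v ≡ true
  pushʳ⇒pushˡ f {u} {v} h with f u v | f v u
  ... | fuv | fvu with P u | P v
  ... | true  | true  = fuv h
  ... | true  | false = fvu h
  ... | false | true  = fvu h
  ... | false | false = fuv h

induced : (Fin n → Fin n → Bool) → VSet n → Fin n → Fin n → Bool
induced a S i j = a i j ∧ (S i ∧ S j)

-- The lower bound

underlying : OrientedGraph n → Graph n
underlying O = record
  { adj    = λ i j → arc O i j ∨ arc O j i
  ; irrefl = λ i → cong₂ _∨_ (loopless O i) (loopless O i)
  ; sym    = λ i j → Bool.∨-comm (arc O i j) (arc O j i)
  }

module _ (O : OrientedGraph n) where

  -- The parity is that of the number of arcs entering the middle vertex `w`; pushing `w` preserves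
  -- it. One path of each parity forms a 4-cycle with an odd number of forward arcs.
  EvenPath OddPath Separated : Fin n → Fin n → Set
  EvenPath u v = ∃[ w ] ((arc O u w ≡ true × arc O v w ≡ true) ⊎ (arc O w u ≡ true × arc O w v ≡ true))
  OddPath u v = ∃[ w ] ((arc O u w ≡ true × arc O w v ≡ true) ⊎ (arc O w u ≡ true × arc O v w ≡ true))
  Separated u v = arc O u v ≡ true ⊎ arc O v u ≡ true ⊎ (EvenPath u v × OddPath u v)

  separated? : ∀ u v → Dec (Separated u v)
  separated? u v = u ⇒? v ⊎-dec v ⇒? u ⊎-dec
    (any? (λ w → (u ⇒? w ×-dec v ⇒? w) ⊎-dec (w ⇒? u ×-dec w ⇒? v)) ×-dec
     any? (λ w → (u ⇒? w ×-dec w ⇒? v) ⊎-dec (w ⇒? u ×-dec v ⇒? w)))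
    where
    infix 8 _⇒?_
    _⇒?_ : ∀ x y → Dec (arc O x y ≡ true)
    x ⇒? y = arc O x y Bool.≟ true

  module _ {H : OrientedGraph k} {P : Fin n → Bool} {φ : Fin n → Fin k}
           (hom : IsHom (push P (arc O)) H φ) where

    hom-arc : ∀ {u v} → arc O u v ≡ true → push P (λ x y → arc H (φ x) (φ y)) u v ≡ true
    hom-arc = pushˡ⇒pushʳ P (arc O) (λ x y → arc H (φ x) (φ y)) hom

    asym : ∀ {x y} → arc H x y ≡ true → arc H y x ≡ true → ⊥
    asym {x} {y} p q = contradiction (trans (≡-sym q) (noOpposite H x y p)) λ ()

    -- Two vertices of the same colour joined by a 2-path: pushing the middle
    -- vertex changes nothing, so the path determines whether they are both pushed.
    evenPath⇒≡ : ∀ {u v} → φ u ≡ φ v → EvenPath u v → P u ≡ P v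
    evenPath⇒≡ {u} {v} e (w , inj₁ (a , b)) with hom-arc a | hom-arc b
    ... | p | q rewrite e with P u | P v | P w
    ... | true  | true  | _     = refl
    ... | false | false | _     = refl
    ... | true  | false | true  = ⊥-elim (asym p q)
    ... | true  | false | false = ⊥-elim (asym p q)
    ... | false | true  | true  = ⊥-elim (asym p q)
    ... | false | true  | false = ⊥-elim (asym p q)
    evenPath⇒≡ {u} {v} e (w , inj₂ (a , b)) with hom-arc a | hom-arc b
    ... | p | q rewrite e with P u | P v | P w
    ... | true  | true  | _     = refl
    ... | false | false | _     = refl
    ... | true  | false | true  = ⊥-elim (asym p q)
    ... | true  | false | false = ⊥-elim (asym p q)
    ... | false | true  | true  = ⊥-elim (asym p q)
    ... | false | true  | false = ⊥-elim (asym p q)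

    oddPath⇒≢ : ∀ {u v} → φ u ≡ φ v → OddPath u v → P u ≢ P v
    oddPath⇒≢ {u} {v} e (w , inj₁ (a , b)) s with hom-arc a | hom-arc b
    ... | p | q rewrite e | s with P v | P w
    ... | true  | true  = asym p q
    ... | true  | false = asym p q
    ... | false | true  = asym p q
    ... | false | false = asym p q
    oddPath⇒≢ {u} {v} e (w , inj₂ (a , b)) s with hom-arc a | hom-arc b
    ... | p | q rewrite e | s with P v | P w
    ... | true  | true  = asym p q
    ... | true  | false = asym p q
    ... | false | true  = asym p q
    ... | false | false = asym p q

    arc⇒≢ : ∀ {u v} → arc O u v ≡ true → φ u ≢ φ v
    arc⇒≢ {u} {v} a e with hom-arc a
    ... | p rewrite e with P u xor P v
    -- With equal colours the image arc is a loop, which is its own opposite.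
    ... | true  = asym p p
    ... | false = asym p p

    separated⇒≢ : ∀ {u v} → Separated u v → φ u ≢ φ v
    separated⇒≢ (inj₁ a)                   e = arc⇒≢ a e
    separated⇒≢ (inj₂ (inj₁ a))            e = arc⇒≢ a (≡-sym e)
    separated⇒≢ (inj₂ (inj₂ (even , odd))) e = oddPath⇒≢ e odd (evenPath⇒≡ e even)

  allSeparated⇒¬ChiPLe : (∀ u v → u ≡ v ⊎ Separated u v) → m < n → ¬ ChiPLe O m
  allSeparated⇒¬ChiPLe sep m<n (k , k≤m , H , P , φ , hom) with pigeonhole (≤-<-trans k≤m m<n) φ
  ... | i , j , i<j , φi≡φj with sep i j
  ...   | inj₁ i≡j = <⇒≢ i<j i≡j
  ...   | inj₂ s   = separated⇒≢ {H = H} {P} hom s φi≡φj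

-- K₂,₃ with parts {0,1} and {2,3,4}, plus the edge 24.  The 4-cycles 0213 and
-- 0314 have an odd number of forward arcs.
obstruction : OrientedGraph 5
obstruction = record
  { arc        = a
  ; loopless   = from-yes (all? λ i → a i i Bool.≟ false)
  ; noOpposite = from-yes (all? λ i → all? λ j → (a i j Bool.≟ true) →-dec (a j i Bool.≟ false))
  }
  where
  a : Fin 5 → Fin 5 → Bool
  a 0F 2F = true
  a 0F 3F = true
  a 0F 4F = true
  a 1F 2F = true
  a 1F 4F = true
  a 3F 1F = true
  a 2F 4F = true
  a _  _  = false

-- A subgraph has at most the edges induced on its vertices, so checking the 32 vertex sets
-- suffices. All five vertices give 14 < 15.
obstruction-mad : MadLt3 (underlying obstruction)
obstruction-mad H 0<V = ≤-<-trans
  (cardPairs-mono (edge H) (induced (adj (underlying obstruction)) (vert H)) λ i j e → ∧-intro (edge⊆adj H i j e)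
    (∧-intro (edge⊆vert H i j e) (edge⊆vert H j i (trans (edge-sym H j i) e))))
  -- Both counts unfold to the five values of the vertex set, so the result for `lookup` is
  -- definitionally the one for `vert H`.
  (sparse (vert H 0F) (vert H 1F) (vert H 2F) (vert H 3F) (vert H 4F) 0<V)
  where
  Sparse : VSet 5 → Set
  Sparse S = 0 < card S → cardPairs (induced (adj (underlying obstruction)) S) < 3 * card S

  sparse? : Decidable Sparse
  sparse? S = (0 <? _) →-dec (_ <? _)

  sparse : ∀ a b c d e → Sparse (lookup (a ∷ b ∷ c ∷ d ∷ e ∷ []))
  sparse = from-yes (∀Bool? λ a → ∀Bool? λ b → ∀Bool? λ c → ∀Bool? λ d → ∀Bool? λ e →
    sparse? (lookup (a ∷ b ∷ c ∷ d ∷ e ∷ [])))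

obstruction-separated : ∀ u v → u ≡ v ⊎ Separated obstruction u v
obstruction-separated = from-yes (all? λ u → all? λ v → (u ≟ v) ⊎-dec separated? obstruction u v)

lowerBound : Σ[ n ∈ ℕ ] Σ[ G ∈ Graph n ] Σ[ O ∈ OrientedGraph n ]
             (MadLt3 G × IsOrientationOf O G × ¬ ChiPLe O 4)
lowerBound = 5 , underlying obstruction , obstruction , obstruction-mad , (λ i j → refl) ,
  allSeparated⇒¬ChiPLe obstruction obstruction-separated ≤-refl

-- The Paley tournament QR₇ and its switching double cover

-- The nonzero squares modulo 7. Since -1 is not one of them, exactly one of i - j and j - i is a
-- residue for i ≠ j, which makes `paley` a tournament.
isResidue : ℕ → Bool
isResidue 1 = true
isResidue 2 = true
isResidue 4 = true
isResidue _ = false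

paley : OrientedGraph 7
paley = record
  { arc        = a
  ; loopless   = from-yes (all? λ i → a i i Bool.≟ false)
  ; noOpposite = from-yes (all? λ i → all? λ j → (a i j Bool.≟ true) →-dec (a j i Bool.≟ false))
  }
  where
  a : Fin 7 → Fin 7 → Bool
  -- The summand 7 keeps j - i modulo 7 clear of truncated subtraction.
  a i j = isResidue ((toℕ j + (7 ∸ toℕ i)) % 7)

-- A state encodes a colour together with the decision whether to push.
State : Set
State = Fin (7 * 2)

colour : State → Fin 7
colour = quotient 2

pushed : State → Bool
pushed s with remainder {7} 2 s
... | zero  = false
... | suc _ = true

-- The double cover turns pushable homomorphisms to `paley` into ordinary homomorphisms: the push
-- decision becomes part of the image.
double : State → State → Bool
double = push pushed (λ s t → arc paley (colour s) (colour t))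

abstract

  -- fit o s t: states s and t are compatible at the ends of an edge, oriented
  -- from the end with state s iff o holds.
  fit : Bool → State → State → Bool
  fit o s t = if o then double s t else double t s

  fit-true : ∀ s t → fit true s t ≡ double s t
  fit-true s t = refl

  fit-not : ∀ o s t → fit (not o) t s ≡ fit o s t
  fit-not true  s t = refl
  fit-not false s t = refl

  -- The out-neighbours of `s` in `double` are the in-neighbours of its antitwin, and conversely.
  antitwin : State → State
  antitwin s = combine (quotient {7} 2 s) (opposite (remainder {7} 2 s))

  -- The only state incompatible with s across a 2-path whose edges have
  -- orientations o and o′ towards its midpoint.
  clash : Bool → Bool → State → State
  clash o o′ s = if o xor o′ then s else antitwin s

  -- The exact number is 6. The bound 4 exceeds every k with k + 2 ≤ 5.
  4≤fit : ∀ o s → 4 ≤ card (fit o s)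
  4≤fit = from-yes (∀Bool? λ o → all? λ s → 4 ≤? card (fit o s))

  -- Any two vertices of QR₇ have one common out-neighbour and one common in-neighbour, so states of
  -- different colours share 2 or 3 compatible states. For equal colours the intersection is empty
  -- or has 6 elements.
  fit-∩ : ∀ o o′ s s′ → card (fit o s ∩ fit o′ s′) ≤ 0 ⊎ 2 ≤ card (fit o s ∩ fit o′ s′)
  fit-∩ = from-yes (∀Bool? λ o → ∀Bool? λ o′ → all? λ s → all? λ s′ →
    (card (fit o s ∩ fit o′ s′) ≤? 0) ⊎-dec (2 ≤? card (fit o s ∩ fit o′ s′)))

  ≢clash⇒fit-∩ : ∀ o o′ s s′ → s′ ≡ clash o o′ s ⊎ 0 < card (fit o s ∩ fit o′ s′)
  ≢clash⇒fit-∩ = from-yes (∀Bool? λ o → ∀Bool? λ o′ → all? λ s → all? λ s′ →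
    (s′ ≟ clash o o′ s) ⊎-dec (0 <? card (fit o s ∩ fit o′ s′)))

  -- A clash keeps the colour of `s`, and QR₇ has no loops. This handles triangles formed by `x` and
  -- two of its small neighbours.
  ¬fit-clash : ∀ o o′ o″ s → fit o″ s (clash o o′ s) ≡ false
  ¬fit-clash = from-yes (∀Bool? λ o → ∀Bool? λ o′ → ∀Bool? λ o″ → all? λ s →
    fit o″ s (clash o o′ s) Bool.≟ false)

-- Discharging

module Discharging (G : Graph n) (S : VSet n) where

  N : Fin n → VSet n
  N = adj G

  deg : Fin n → ℕ
  deg x = card (N x ∩ S)

  small : VSet n
  small x = does (deg x ≤? 2)

  #small #large : Fin n → ℕ
  #small x = card (N x ∩ S ∩ small)
  #large x = card (N x ∩ S ∖ small)

  incidences : VSet n → VSet n → ℕ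
  incidences A B = sum (λ i → [ A i ] * card (N i ∩ B))

  incidences≡sum : ∀ A B → incidences A B ≡ sum (λ i → sum (λ j → [ A i ] * [ N i j ∧ B j ]))
  incidences≡sum A B = sum-cong-≗ λ i →
    trans (cong ([ A i ] *_) (card≡sum (N i ∩ B))) (*-distribˡ-sum [ A i ] (λ j → [ N i j ∧ B j ]))

  -- Double counting over the symmetric adjacency. In the discharging it equates the charge sent to
  -- small neighbours with the charge that small vertices receive.
  incidences-comm : ∀ A B → incidences A B ≡ incidences B A
  incidences-comm A B = begin
    incidences A B                                    ≡⟨ incidences≡sum A B ⟩
    sum (λ i → sum (λ j → [ A i ] * [ N i j ∧ B j ]))
      ≡⟨ ∑-comm (λ i j → [ A i ] * [ N i j ∧ B j ]) ⟩
    sum (λ j → sum (λ i → [ A i ] * [ N i j ∧ B j ]))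
      ≡⟨ sum-cong-≗ (λ j → sum-cong-≗ (λ i → swap (A i) (B j) (sym G i j))) ⟩
    sum (λ j → sum (λ i → [ B j ] * [ N j i ∧ A i ])) ≡⟨ incidences≡sum B A ⟨
    incidences B A                                    ∎
    where
    open ≡-Reasoning
    swap : ∀ a b {c d} → c ≡ d → [ a ] * [ c ∧ b ] ≡ [ b ] * [ d ∧ a ]
    swap true  true  {c}     refl = refl
    swap true  false {true}  refl = refl
    swap true  false {false} refl = refl
    swap false true  {true}  refl = refl
    swap false true  {false} refl = refl
    swap false false {c}     refl = refl

  inducedSubgraph : Subgraph G
  inducedSubgraph = record
    { vert      = S
    ; edge      = induced N S
    ; edge-sym  = λ i j → cong₂ _∧_ (sym G i j) (Bool.∧-comm (S i) (S j))
    ; edge⊆adj  = λ i j → ∧-elimˡ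
    ; edge⊆vert = λ i j p → ∧-elimˡ (∧-elimʳ {N i j} p)
    }

  cardPairs-induced : cardPairs (induced N S) ≡ incidences S S
  cardPairs-induced = trans (cardPairs≡sum (induced N S)) (sum-cong-≗ row)
    where
    row : ∀ i → card (induced N S i) ≡ [ S i ] * deg i
    row i with S i
    ... | true  = ≡-sym (*-identityˡ (deg i))
    ... | false = trans (card-cong λ j → Bool.∧-zeroʳ (N i j)) (card-false n)

  sum-linear : ∀ c (a b : Fin n → ℕ) → sum (λ i → c * a i + b i) ≡ c * sum a + sum b
  sum-linear c a b = trans (∑-distrib-+ (λ i → c * a i) b) (cong (_+ sum b) (≡-sym (*-distribˡ-sum c a)))

  -- Every vertex x has charge 2 (deg x) − 6 and sends 1 to each small neighbour.
  -- The total charge is negative, so some final charge is.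
  negativeCharge : MadLt3 G → 0 < card S →
    ∃[ x ] (x ∈ S × 2 * deg x + [ small x ] * deg x < 6 + #small x)
  negativeCharge mad 0<S with sum-<⇒∃ f g (subst₂ _<_ (≡-sym sumf) (≡-sym sumg) total)
    where
    f g : Fin n → ℕ
    -- To avoid subtraction, `f` collects twice the degree and the charge received, `g` the constant
    -- 6 and the charge sent. The final charge is negative where `f` is less than `g`.
    f i = 2 * ([ S i ] * deg i) + [ S i ∧ small i ] * deg i
    g i = 6 * [ S i ] + [ S i ] * card (N i ∩ (S ∩ small))
    sumf : sum f ≡ 2 * incidences S S + incidences (S ∩ small) S
    sumf = sum-linear 2 (λ i → [ S i ] * deg i) (λ i → [ S i ∧ small i ] * deg i)
    sumg : sum g ≡ 6 * card S + incidences (S ∩ small) S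
    sumg = trans (sum-linear 6 (λ i → [ S i ]) (λ i → [ S i ] * card (N i ∩ (S ∩ small))))
                 (cong₂ (λ a b → 6 * a + b) (≡-sym (card≡sum S)) (incidences-comm S (S ∩ small)))
    total : 2 * incidences S S + incidences (S ∩ small) S < 6 * card S + incidences (S ∩ small) S
    total = +-monoˡ-< (incidences (S ∩ small) S)
      (subst (2 * incidences S S <_) (≡-sym (*-assoc 2 3 (card S)))
        (*-monoʳ-< 2 (subst (_< 3 * card S) cardPairs-induced (mad inducedSubgraph 0<S))))
  ... | x , p = x , atVertex (S x) refl p
    where
    atVertex : ∀ b → S x ≡ b →
      2 * ([ b ] * deg x) + [ b ∧ small x ] * deg x < 6 * [ b ] + [ b ] * card (N x ∩ (S ∩ small)) →
      S x ≡ true × 2 * deg x + [ small x ] * deg x < 6 + #small x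
    -- Outside `S` both sides compute to 0, so the case `false` is absurd.
    atVertex true e q = e , subst₂ _<_
      (cong (λ d → 2 * d + [ small x ] * deg x) (*-identityˡ (deg x)))
      (cong (6 +_) (trans (*-identityˡ _) (card-cong λ j → ≡-sym (Bool.∧-assoc (N x j) (S j) (small j))))) q

  -- Let d = k + r with k small and r large neighbours. For d = 2 the final charge is -k, so k ≥ 1.
  -- For d ≥ 3 it is 2d - 6 - k = k + 2r - 6, which is negative, and k = 0 would make it at least 0.
  reducible : MadLt3 G → 0 < card S →
    ∃[ x ] (x ∈ S × (deg x ≤ 1 ⊎ (0 < #small x × #small x + 2 * #large x ≤ 5)))
  reducible mad 0<S with negativeCharge mad 0<S
  ... | x , x∈S , p = x , x∈S , cases (deg x ≤? 2) p (card-split (N x ∩ S) small)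
    where
    two : ∀ {k r} → 6 < 6 + k → 2 ≡ k + r → 0 < k × k + 2 * r ≤ 5
    two {0}                 p _    = contradiction p (<-irrefl refl)
    two {1} {1}             _ refl = s≤s z≤n , from-yes (3 ≤? 5)
    two {2} {0}             _ refl = s≤s z≤n , from-yes (2 ≤? 5)
    two {1} {0}             _ ()
    two {1} {suc (suc _)}   _ ()
    two {2} {suc _}         _ ()
    two {suc (suc (suc _))} _ ()

    identity : ∀ k r → 2 * (k + r) + 0 ≡ k + (k + 2 * r)
    identity = solve-∀

    large : ∀ {k r} → ¬ k + r ≤ 2 → 2 * (k + r) + 0 < 6 + k → 0 < k × k + 2 * r ≤ 5
    large {zero} {r} d≰2 p =
      contradiction (subst (_< 6) (+-identityʳ (2 * r)) p) (≤⇒≯ (*-monoʳ-≤ 2 (≰⇒> d≰2)))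
    large {suc k} {r} _ p = s≤s z≤n , s≤s⁻¹ (+-cancelˡ-< (suc k) _ _
      (subst₂ _<_ (identity (suc k) r) (+-comm 6 (suc k)) p))

    cases : ∀ {d k r} (s : Dec (d ≤ 2)) → 2 * d + [ does s ] * d < 6 + k → d ≡ k + r →
            d ≤ 1 ⊎ (0 < k × k + 2 * r ≤ 5)
    cases {zero} (yes _) _ _ = inj₁ z≤n
    cases {suc zero} (yes _) _ _ = inj₁ ≤-refl
    cases {suc (suc zero)} (yes _) p e = inj₂ (two p e)
    cases {suc (suc (suc _))} (yes (s≤s (s≤s ()))) _ _
    cases {d} (no d≰2) p e = inj₂ (large (subst (λ d → ¬ d ≤ 2) e d≰2) (subst (λ d → 2 * d + 0 < _) e p))

-- Extending colourings

module Colouring (G : Graph n) (O : OrientedGraph n) (orients : IsOrientationOf O G) where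

  N : Fin n → VSet n
  N = adj G

  N-sym : ∀ {u v} → u ∈ N v → v ∈ N u
  N-sym {u} {v} p = trans (sym G u v) p

  N-irrefl : ∀ {x} → ¬ x ∈ N x
  N-irrefl {x} p = contradiction (trans (≡-sym p) (irrefl G x)) λ ()

  arc-flip : ∀ {u v} → u ∈ N v → arc O u v ≡ not (arc O v u)
  arc-flip {u} {v} p with arc O v u in e
  ... | true  = noOpposite O v u e
  ... | false = trans (cong (_∨ arc O u v) (≡-sym e)) (trans (≡-sym (orients v u)) p)

  -- A partial colouring: `σ` is total, but its values outside `T` are dummies.
  Proper : VSet n → (Fin n → State) → Set
  Proper T σ = ∀ {u v} → u ∈ T → v ∈ T → u ∈ N v → fit (arc O u v) (σ u) (σ v) ≡ true

  Fits : VSet n → (Fin n → State) → Fin n → State → Set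
  Fits T σ x t = ∀ {y} → y ∈ T → y ∈ N x → fit (arc O y x) (σ y) t ≡ true

  -- `x` may lie in `T′` without lying in `T`, so this covers both colouring a new vertex and
  -- changing the state of an old one.
  recolour : ∀ {T T′ σ x t} → (∀ {u} → u ∈ T′ → x ≢ u → u ∈ T) →
             Proper T σ → Fits T σ x t → Proper T′ (updateAt σ x (const t))
  recolour {T} {T′} {σ} {x} {t} sub proper fits {u} {v} u∈T′ v∈T′ u∈Nv with x ≟ u | x ≟ v
  ... | yes refl | yes refl = contradiction u∈Nv N-irrefl
  ... | yes refl | no x≢v
    rewrite updateAt-updates x {const t} σ | updateAt-minimal v x {const t} σ (x≢v ∘ ≡-sym)
          | arc-flip u∈Nv | fit-not (arc O v x) (σ v) t = fits (sub v∈T′ x≢v) (N-sym u∈Nv)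
  ... | no x≢u | yes refl
    rewrite updateAt-updates x {const t} σ | updateAt-minimal u x {const t} σ (x≢u ∘ ≡-sym) =
    fits (sub u∈T′ x≢u) u∈Nv
  ... | no x≢u | no x≢v
    rewrite updateAt-minimal u x {const t} σ (x≢u ∘ ≡-sym)
          | updateAt-minimal v x {const t} σ (x≢v ∘ ≡-sym) =
    proper (sub u∈T′ x≢u) (sub v∈T′ x≢v) u∈Nv

  -- States left by the coloured neighbours of a vertex

  module _ (T : VSet n) (σ : Fin n → State) (x : Fin n) where

    options≤1 : card (N x ∩ T) ≤ 1 → ∃[ A ] (4 ≤ card A × (∀ {t} → t ∈ A → Fits T σ x t))
    options≤1 p with card-≤1+-pick (N x ∩ T) p
    ... | inj₁ none = const true , from-yes (4 ≤? 14) ,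
      λ _ y∈T y∈N → contradiction (∧-intro y∈N y∈T) (card≤0⇒∉ (N x ∩ T) none)
    ... | inj₂ (y , y∈NT , _) = fit (arc O y x) (σ y) , 4≤fit (arc O y x) (σ y) , only
      where
      only : ∀ {t} → fit (arc O y x) (σ y) t ≡ true → Fits T σ x t
      only q y′∈T y′∈N rewrite card≤1⇒≡ (N x ∩ T) p (∧-intro y′∈N y′∈T) y∈NT = q

    -- The state `s` already fits both neighbours. This rules out the empty alternative of `fit-∩`,
    -- so at least 2 states remain.
    options≤2 : ∀ {s} → Fits T σ x s → card (N x ∩ T) ≤ 2 →
                ∃[ A ] (2 ≤ card A × (∀ {t} → t ∈ A → Fits T σ x t))
    options≤2 {s} fits p with card-≤1+-pick (N x ∩ T) p
    ... | inj₁ none = let A , 4≤A , good = options≤1 (≤-trans none z≤n)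
                      in A , ≤-trans (from-yes (2 ≤? 4)) 4≤A , good
    ... | inj₂ (y , y∈NT , p′) with card-≤1+-pick (N x ∩ T ∖ ⁅ y ⁆) p′
    ...   | inj₁ none = let A , 4≤A , good = options≤1 (≤-trans (card≤1+card-∖⁅⁆ (N x ∩ T) y) (s≤s none))
                        in A , ≤-trans (from-yes (2 ≤? 4)) 4≤A , good
    ...   | inj₂ (y′ , y′∈NT , _) = A , 2≤A , both
      where
      A : VSet 14
      A = fit (arc O y x) (σ y) ∩ fit (arc O y′ x) (σ y′)

      s∈A : s ∈ A
      s∈A = ∧-intro (fits (∧-elimʳ {N x y} y∈NT) (∧-elimˡ y∈NT))
                    (fits (∧-elimʳ {N x y′} (∧-elimˡ y′∈NT)) (∧-elimˡ (∧-elimˡ y′∈NT)))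

      2≤A : 2 ≤ card A
      2≤A with fit-∩ (arc O y x) (arc O y′ x) (σ y) (σ y′)
      ... | inj₁ empty = contradiction s∈A (card≤0⇒∉ A empty)
      ... | inj₂ q     = q

      both : ∀ {t} → t ∈ A → Fits T σ x t
      both {t} q {z} z∈T z∈N with y ≟ z
      ... | yes refl = ∧-elimˡ q
      ... | no y≢z rewrite card≤1⇒≡ (N x ∩ T ∖ ⁅ y ⁆) p′ (∈-∖⁅⁆⁺ {A = N x ∩ T} (∧-intro z∈N z∈T) y≢z) y′∈NT =
        ∧-elimʳ {fit (arc O y x) (σ y) t} q

    -- For r = 0, 1, 2 there remain 14, at least 4 and at least 2 states, while k + 2r ≤ 5 bounds k
    -- by 5, 3 and 1. The strict excess over k is what `avoid` asks for.
    options : ∀ {s} k r → Fits T σ x s → card (N x ∩ T) ≤ r → k + 2 * r ≤ 5 →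
              ∃[ A ] (k < card A × (∀ {t} → t ∈ A → Fits T σ x t))
    options k 0 fits p q = const true ,
      ≤-trans (s≤s (≤-trans (m≤m+n k 0) q)) (from-yes (6 ≤? 14)) ,
      λ _ y∈T y∈N → contradiction (∧-intro y∈N y∈T) (card≤0⇒∉ (N x ∩ T) p)
    options k 1 fits p q = let A , 4≤A , good = options≤1 p
                           in A , ≤-trans (s≤s (+-cancelʳ-≤ 2 k 3 q)) 4≤A , good
    options k 2 fits p q = let A , 2≤A , good = options≤2 fits p
                           in A , ≤-trans (s≤s (+-cancelʳ-≤ 4 k 1 q)) 2≤A , good
    options k (suc (suc (suc r))) fits p q = contradiction
      (≤-trans (*-monoʳ-≤ 2 {3} {suc (suc (suc r))} (s≤s (s≤s (s≤s z≤n)))) (≤-trans (m≤n+m _ k) q))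
      (<⇒≱ (from-yes (5 <? 6)))

  -- Compatible w x y: the states of x and y leave a choice for a common neighbour w.
  Compatible : (Fin n → State) → Fin n → Fin n → Fin n → Set
  Compatible σ w x y = σ x ≢ clash (arc O y w) (arc O x w) (σ y)

  -- Colouring the small neighbours of `x`

  module _ (S : VSet n) (x : Fin n) where

    otherNeighbour≤1 : ∀ {w} → x ∈ S → x ∈ N w → card (N w ∩ S) ≤ 2 → card (N w ∩ S ∖ ⁅ x ⁆) ≤ 1
    otherNeighbour≤1 {w} x∈S x∈N d = s≤s⁻¹ (≤-trans (card-∖⁅⁆-< (N w ∩ S) (∧-intro x∈N x∈S)) d)

    -- The invariant of `fill`. A second neighbour of `w` that is still uncoloured imposes nothing
    -- yet; compatibility with it must be shown when it is coloured.
    Pending : VSet n → (Fin n → State) → Set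
    Pending T σ = ∀ {w} → w ∈ S ∖ T →
      w ∈ N x × card (N w ∩ S) ≤ 2 × (∀ {y} → y ∈ T → y ∈ N w → x ≢ y → Compatible σ w x y)

    -- At most one coloured neighbour besides `x` constrains `w`. Without one, any state compatible
    -- with that of `x` will do; with one, compatibility excludes the single clashing state.
    fillOne : ∀ {T σ w} → T ⊆ S → x ∈ T → w ∈ S ∖ T → Pending T σ → ∃[ t ] Fits T σ w t
    fillOne {T} {σ} {w} T⊆S x∈T w∈ pending with pending w∈
    ... | w∈Nx , d , compatible with card-≤1+-pick (N w ∩ T ∖ ⁅ x ⁆) ≤1
      where
      ≤1 : card (N w ∩ T ∖ ⁅ x ⁆) ≤ 1
      ≤1 = ≤-trans (card-mono (N w ∩ T ∖ ⁅ x ⁆) (N w ∩ S ∖ ⁅ x ⁆) λ i q →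
             ∧-intro (∧-intro (∧-elimˡ (∧-elimˡ q)) (T⊆S i (∧-elimʳ {N w i} (∧-elimˡ q)))) (∧-elimʳ {N w i ∧ T i} q))
             (otherNeighbour≤1 (T⊆S x x∈T) (N-sym w∈Nx) d)
    ...   | inj₁ none with 0<card⇒∃ _ (≤-trans (s≤s z≤n) (4≤fit (arc O x w) (σ x)))
    ...     | t , q = t , only
      where
      only : Fits T σ w t
      only {z} z∈T z∈N with x ≟ z
      ... | yes refl = q
      ... | no x≢z   = contradiction (∈-∖⁅⁆⁺ {A = N w ∩ T} (∧-intro z∈N z∈T) x≢z) (card≤0⇒∉ (N w ∩ T ∖ ⁅ x ⁆) none)
    fillOne {T} {σ} {w} T⊆S x∈T w∈ pending | w∈Nx , d , compatible | inj₂ (y , y∈ , none)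
      with ≢clash⇒fit-∩ (arc O y w) (arc O x w) (σ y) (σ x)
    ... | inj₁ e = contradiction e
      (compatible (∧-elimʳ {N w y} (∧-elimˡ y∈)) (∧-elimˡ (∧-elimˡ y∈)) (∈-∖⁅⁆⁻ {A = N w ∩ T} y∈))
    ... | inj₂ 0<A with 0<card⇒∃ _ 0<A
    ...   | t , q = t , both
      where
      both : Fits T σ w t
      both {z} z∈T z∈N with x ≟ z | y ≟ z
      ... | yes refl | _        = ∧-elimʳ {fit (arc O y w) (σ y) t} q
      ... | no _     | yes refl = ∧-elimˡ q
      ... | no x≢z   | no y≢z   = contradiction
        (∈-∖⁅⁆⁺ {A = N w ∩ T ∖ ⁅ x ⁆} (∈-∖⁅⁆⁺ {A = N w ∩ T} (∧-intro z∈N z∈T) x≢z) y≢z)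
        (card≤0⇒∉ (N w ∩ T ∖ ⁅ x ⁆ ∖ ⁅ y ⁆) none)

    proper-⊇ : ∀ {T σ} → card (S ∖ T) ≤ 0 → Proper T σ → Proper S σ
    proper-⊇ {T} none proper u∈S v∈S = proper (sub u∈S) (sub v∈S)
      where
      sub : ∀ {i} → i ∈ S → i ∈ T
      sub {i} i∈S with T i in e
      ... | true  = refl
      ... | false = contradiction (∧-intro i∈S (cong not e)) (card≤0⇒∉ (S ∖ T) none)

    -- The pending vertices are coloured one by one, `m` bounding how many are left. The state of
    -- `x` stays fixed throughout.
    fill : ∀ m {T σ} → card (S ∖ T) ≤ m → T ⊆ S → x ∈ T → Proper T σ → Pending T σ →
           ∃[ σ′ ] Proper S σ′
    fill zero {T} {σ} p T⊆S x∈T proper pending = σ , λ {u} {v} → proper-⊇ {T} {σ} p proper {u} {v}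
    fill (suc m) {T} {σ} p T⊆S x∈T proper pending with card-≤1+-pick (S ∖ T) p
    ... | inj₁ none = σ , λ {u} {v} → proper-⊇ {T} {σ} none proper {u} {v}
    ... | inj₂ (w , w∈ , p′) with fillOne T⊆S x∈T w∈ pending
    ...   | t , fits = fill m {T′} {σ′} p″ T′⊆S (∈-∪⁺ˡ T ⁅ w ⁆ x x∈T) proper′ pending′
      where
      T′ = T ∪ ⁅ w ⁆
      σ′ = updateAt σ w (const t)

      w∉T : ¬ w ∈ T
      w∉T q = contradiction (trans (≡-sym (cong not q)) (∧-elimʳ {S w} w∈)) λ ()

      old : ∀ {i} → i ∈ T → σ′ i ≡ σ i
      old {i} i∈T = updateAt-minimal i w σ λ { refl → w∉T i∈T }

      sub : ∀ {u} → u ∈ T′ → w ≢ u → u ∈ T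
      sub u∈T′ w≢u = [ (λ q → q) , (λ q → contradiction (∈-⁅⁆⁻ {x = w} q) w≢u) ]′ (∈-∪⁻ T ⁅ w ⁆ u∈T′)

      proper′ : Proper T′ σ′
      proper′ = recolour {T} {T′} {σ} sub proper fits

      T′⊆S : T′ ⊆ S
      T′⊆S i i∈T′ with w ≟ i
      ... | yes refl = ∧-elimˡ w∈
      -- Here membership in `T′` computes to `T i ∨ false`, hence the empty second set.
      ... | no w≢i   = T⊆S i ([ (λ q → q) , (λ ()) ]′ (∈-∪⁻ T (const false) i∈T′))

      ∖T′⊆ : S ∖ T′ ⊆ S ∖ T ∖ ⁅ w ⁆
      ∖T′⊆ i q with S i | T i | ⁅ w ⁆ i
      ... | true | false | false = refl

      p″ : card (S ∖ T′) ≤ m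
      p″ = ≤-trans (card-mono (S ∖ T′) (S ∖ T ∖ ⁅ w ⁆) ∖T′⊆) p′

      pending′ : Pending T′ σ′
      pending′ {w′} w′∈ with pending (∧-elimˡ (∖T′⊆ w′ w′∈))
      ... | w′∈Nx , d , compatible = w′∈Nx , d , compatible′
        where
        compatible′ : ∀ {y} → y ∈ T′ → y ∈ N w′ → x ≢ y → Compatible σ′ w′ x y
        compatible′ {y} y∈T′ y∈Nw′ x≢y e with ∈-∪⁻ T ⁅ w ⁆ y∈T′
        ... | inj₁ y∈T = compatible y∈T y∈Nw′ x≢y
          (trans (≡-sym (old x∈T)) (trans e (cong (clash (arc O y w′) (arc O x w′)) (old y∈T))))
        -- The vertex just coloured is itself the other neighbour of `w′`. It is adjacent to `x`, so
        -- their states are compatible, which those of a clash never are.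
        ... | inj₂ y∈⁅w⁆ with ∈-⁅⁆⁻ {x = w} {y} y∈⁅w⁆
        ...   | refl = contradiction
          (trans (≡-sym (proper′ y∈T′ (∈-∪⁺ˡ T ⁅ w ⁆ x x∈T) (proj₁ (pending w∈))))
            (trans (cong (fit (arc O w x) (σ′ w)) e)
                   (¬fit-clash (arc O w w′) (arc O x w′) (arc O w x) (σ′ w))))
          λ ()

  -- Induction on the coloured vertex set

  module _ (mad : MadLt3 G) where

    -- The graph stays fixed while `S` shrinks, since the bound on mad covers all induced subgraphs.
    -- A step may remove several vertices, so the induction runs on an upper bound `m`.
    colouring : ∀ m S → card S ≤ m → ∃[ σ ] Proper S σ
    colouring zero S p = const zero , λ u∈S → contradiction u∈S (card≤0⇒∉ S p)
    colouring (suc m) S p with card S ≤? 0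
    ... | yes q = const zero , λ u∈S → contradiction u∈S (card≤0⇒∉ S q)
    ... | no ¬q with Discharging.reducible G S mad (≰⇒> ¬q)
    ...   | x , x∈S , inj₁ d≤1 = extend (colouring m S₀ (s≤s⁻¹ (≤-trans (card-∖⁅⁆-< S x∈S) p)))
      where
      S₀ = S ∖ ⁅ x ⁆

      extend : ∃[ σ ] Proper S₀ σ → ∃[ σ ] Proper S σ
      extend (σ , proper) with options≤1 S₀ σ x
        (≤-trans (card-mono (N x ∩ S₀) (N x ∩ S) λ i q → ∧-intro (∧-elimˡ {N x i} q) (∧-elimˡ (∧-elimʳ {N x i} q))) d≤1)
      ... | A , 4≤A , good with 0<card⇒∃ A (≤-trans (s≤s z≤n) 4≤A)
      ...   | t , t∈A = updateAt σ x (const t) ,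
        recolour {S₀} {S} {σ} (∈-∖⁅⁆⁺ {A = S}) proper (good t∈A)
    colouring (suc m) S p | no ¬q | x , x∈S , inj₂ (0<k , k+2r≤5) =
      extend (colouring m S′ (s≤s⁻¹ (≤-trans (smaller (0<card⇒∃ W 0<k)) p)))
      where
      open Discharging G S using (small; #small; #large)

      W S′ : VSet n
      W = N x ∩ S ∩ small
      -- `x` is not its own neighbour, so it stays coloured even when it is small.
      S′ = S ∖ (N x ∩ small)

      S′⊆S : S′ ⊆ S
      S′⊆S i = ∧-elimˡ

      S∖S′⊆W : S ∖ S′ ⊆ W
      S∖S′⊆W i q with S i | N x i | small i
      ... | true | true | true = refl

      W∩S′ : ∀ {i} → i ∈ W → ¬ i ∈ S′
      W∩S′ {i} a b with S i | N x i | small i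
      W∩S′ a () | true  | true  | true
      W∩S′ () b | true  | true  | false

      smaller : ∃[ w ] w ∈ W → card S′ < card S
      smaller (w , w∈W) = ≤-trans
        (s≤s (card-mono S′ (S ∖ ⁅ w ⁆) λ i q → ∈-∖⁅⁆⁺ {A = S} {w} (∧-elimˡ q) λ { refl → W∩S′ w∈W q }))
        (card-∖⁅⁆-< S (∧-elimʳ {N x w} (∧-elimˡ w∈W)))

      x∈S′ : x ∈ S′
      x∈S′ = ∧-intro x∈S (cong (λ b → not (b ∧ small x)) (irrefl G x))

      N∩S′⊆large : N x ∩ S′ ⊆ N x ∩ S ∖ small
      N∩S′⊆large i q with S i | N x i | small i
      ... | true | true | false = refl

      deg≤2 : ∀ {w} → w ∈ W → card (N w ∩ S) ≤ 2
      deg≤2 {w} w∈W = does⇒ (card (N w ∩ S) ≤? 2) (∧-elimʳ {N x w ∧ S w} w∈W)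

      extend : ∃[ σ ] Proper S′ σ → ∃[ σ ] Proper S σ
      extend (σ , proper) with options S′ σ x (#small x) (#large x) (λ y∈S′ → proper y∈S′ x∈S′)
                                 (card-mono (N x ∩ S′) (N x ∩ S ∖ small) N∩S′⊆large) k+2r≤5
      ... | A , k<A , good = finish (avoid A W forbidden k<A)
        where
        other? : ∀ w → Dec (∃[ y ] y ∈ N w ∩ S ∖ ⁅ x ⁆)
        other? w = any? λ y → _ Bool.≟ true

        forbidden : Fin n → State
        forbidden w with other? w
        ... | yes (y , _) = clash (arc O y w) (arc O x w) (σ y)
        -- An arbitrary default: the count already grants one forbidden state to each `w`.
        ... | no _        = σ x

        forbidden-clash : ∀ {w y} → w ∈ W → y ∈ S → y ∈ N w → x ≢ y →
                          clash (arc O y w) (arc O x w) (σ y) ≡ forbidden w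
        forbidden-clash {w} {y} w∈W y∈S y∈N x≢y with other? w
        ... | no none = contradiction (y , ∈-∖⁅⁆⁺ {A = N w ∩ S} (∧-intro y∈N y∈S) x≢y) none
        ... | yes (y′ , y′∈) = cong (λ z → clash (arc O z w) (arc O x w) (σ z))
          (card≤1⇒≡ (N w ∩ S ∖ ⁅ x ⁆)
            (otherNeighbour≤1 S x x∈S (N-sym (∧-elimˡ (∧-elimˡ w∈W))) (deg≤2 w∈W))
            (∈-∖⁅⁆⁺ {A = N w ∩ S} (∧-intro y∈N y∈S) x≢y) y′∈)

        finish : ∃[ t ] (t ∈ A × (∀ {w} → w ∈ W → t ≢ forbidden w)) → ∃[ σ′ ] Proper S σ′
        finish (t , t∈A , avoids) = fill S x _ {S′} {σ₁} ≤-refl S′⊆S x∈S′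
          (recolour {S′} {S′} {σ} (λ q _ → q) proper (good t∈A)) pending
          where
          σ₁ = updateAt σ x (const t)

          pending : Pending S x S′ σ₁
          pending {w} w∈ = ∧-elimˡ (∧-elimˡ w∈W) , deg≤2 w∈W , compatible
            where
            w∈W = S∖S′⊆W w w∈
            compatible : ∀ {y} → y ∈ S′ → y ∈ N w → x ≢ y → Compatible σ₁ w x y
            compatible {y} y∈S′ y∈N x≢y e = avoids w∈W (begin
              t                                    ≡⟨ updateAt-updates x σ ⟨
              σ₁ x                                 ≡⟨ e ⟩
              clash (arc O y w) (arc O x w) (σ₁ y)
                ≡⟨ cong (clash (arc O y w) (arc O x w)) (updateAt-minimal y x σ (x≢y ∘ ≡-sym)) ⟩
              clash (arc O y w) (arc O x w) (σ y)  ≡⟨ forbidden-clash w∈W (S′⊆S y y∈S′) y∈N x≢y ⟩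
              forbidden w                          ∎)
              where open ≡-Reasoning

    -- The states give both the pushed set and the colours. Moving the push from the target back to
    -- the source turns a homomorphism to the double cover into a pushable one.
    pushColouring : PushColorable O 7
    pushColouring with colouring n (const true) (card≤n n)
      where
      card≤n : ∀ n → card {n} (const true) ≤ n
      card≤n zero    = z≤n
      card≤n (suc n) = s≤s (card≤n n)
    ... | σ , proper = paley , pushed ∘ σ , colour ∘ σ , λ u v →
      pushʳ⇒pushˡ (pushed ∘ σ) (arc O) (λ x y → arc paley (colour (σ x)) (colour (σ y))) double-arc {u} {v}
      where
      double-arc : ∀ u v → arc O u v ≡ true → double (σ u) (σ v) ≡ true
      double-arc u v a = trans (≡-sym (fit-true (σ u) (σ v)))
        (trans (cong (λ o → fit o (σ u) (σ v)) (≡-sym a))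
          (proper refl refl (trans (orients v u) (trans (cong (arc O v u ∨_) a) (Bool.∨-zeroʳ _)))))

theorem5 : (Σ[ n ∈ ℕ ] Σ[ G ∈ Graph n ] Σ[ O ∈ OrientedGraph n ]
    (MadLt3 G × IsOrientationOf O G × ¬ ChiPLe O 4))
    ×
    ((n : ℕ) (G : Graph n) → MadLt3 G →
    (O : OrientedGraph n) → IsOrientationOf O G → ChiPLe O 7)
theorem5 = lowerBound , λ n G mad O orients → 7 , ≤-refl , Colouring.pushColouring G O orients mad
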